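{- Let $s\ge 2$ and $n$ be positive integers and let $t_1,\ldots,t_s$ be integers with $0\le t_i<s$ for each $1\le i\le s$ and $n\ge t_1+\cdots+t_s$. Suppose that $\mathcal{F}\subset [s]^n$ is $(t_1,\ldots,t_s)$-intersecting. Then $$|\mathcal{F}|\le s^{\,n-\sum_{i=1}^s t_i}.$$
   Context: $[s]=\{1,\ldots,s\}$ and $[s]^n$ is the set of all sequences $\vec y=(y_1,\ldots,y_n)$ with $y_j\in[s]$. For non-negative integers $t_1,\ldots,t_s$, a family $\mathcal{F}\subset[s]^n$ is called $(t_1,\ldots,t_s)$-intersecting if for all $\vec y,\vec z\in\mathcal{F}$ (not necessarily distinct) and every $\ell\in[s]$, the number of coordinates $j\in[n]$ with $y_j=z_j=\ell$ is at least $t_\ell$. -}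

module Defs where

open import Data.Nat using (ℕ; zero; suc; _+_; _≤_)
open import Data.Fin using (Fin)
open import Data.Fin.Properties using (_≟_)
open import Data.Vec using (Vec; []; _∷_)
open import Data.List using (List; map; allFin)
open import Data.Nat.ListAction using (sum)
open import Data.List.Membership.Propositional using (_∈_)
open import Data.Bool using (true; false)
open import Relation.Nullary.Decidable using (does; _×-dec_)
open import Relation.Binary.PropositionalEquality using (_≡_)
open import Data.Product using (_×_)

-- A word in [s]^n; the letter  i : Fin s  stands for the symbol (toℕ i + 1) of [s].
Word : ℕ → ℕ → Set
Word s n = Vec (Fin s) n

agreeOn : ∀ {s n} → Fin s → Word s n → Word s n → ℕ
agreeOn ℓ [] [] = 0
agreeOn ℓ (y ∷ ys) (z ∷ zs) with does ((y ≟ ℓ) ×-dec (z ≟ ℓ))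
... | true  = suc (agreeOn ℓ ys zs)
... | false = agreeOn ℓ ys zs

IsIntersecting : ∀ {s n} → (Fin s → ℕ) → List (Word s n) → Set
IsIntersecting {s} {n} t F =
  ∀ (y z : Word s n) → y ∈ F → z ∈ F → ∀ (ℓ : Fin s) → t ℓ ≤ agreeOn ℓ y z

totalT : ∀ {s} → (Fin s → ℕ) → ℕ
totalT {s} t = sum (map t (allFin s))

{-# OPTIONS --safe #-}
-- The positions of the letter ℓ in the words of F generate an up-closed family
-- U ℓ of subsets of [n] any two members of which meet in at least t ℓ points.
-- Give a subset the weight c^(n - size), where c = s - 1, i.e. s^n times its
-- probability as the set of positions of ℓ in a random word.
--
-- Friedgut's form of the Hoffman bound gives weight (U ℓ) ≤ s^(n - t ℓ): there
-- is a quadratic form, diagonal in the biased Fourier basis with nonnegative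
-- eigenvalues when t ℓ ≤ c, whose value at the indicator f of U ℓ is both
-- s^n weight (f²) and at least s^(t ℓ) (weight f)².
--
-- The events "the positions of ℓ lie in U ℓ" depend monotonically on the
-- indicators [y_j = ℓ], exactly one of which is 1 for each j, so they are
-- negatively correlated, and the s bounds multiply.
module Submission where

open import Defs
import Data.Nat as ℕ
import Data.Nat.Properties as ℕ
import Data.Nat.Tactic.RingSolver as ℕ-Solver
open import Data.Nat using (ℕ; zero; suc; z≤n; s≤s)
open import Data.Integer as ℤ using (ℤ; +_; 0ℤ; 1ℤ; +≤+)
import Data.Integer.Properties as ℤ
open import Data.Integer.Tactic.RingSolver using (solve-∀)
open import Data.Bool using (Bool; true; false; if_then_else_)
open import Data.Fin using (Fin; zero; suc)
open import Data.Fin.Properties using (_≟_)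
open import Data.Fin.Subset using (Subset; inside; outside; ∣_∣; _∩_; ⊥; _⊆_)
open import Data.Fin.Subset.Properties
  using (∣⊥∣≡0; _⊆?_; ⊆-refl; ⊆-trans; out⊆; s⊆s; x∈p∩q⁺; x∈p∩q⁻; p⊆q⇒∣p∣≤∣q∣)
open import Data.List as List using (List; []; _∷_; length)
open import Data.List.Properties using (map-tabulate)
open import Data.List.Membership.Propositional using (_∈_; find; lose)
open import Data.List.Relation.Unary.All as All using ()
open import Data.List.Relation.Unary.AllPairs using (_∷_)
open import Data.List.Relation.Unary.Any as Any using (Any; any?; here; there)
open import Data.List.Relation.Unary.Unique.Propositional using (Unique)
import Data.Nat.ListAction as ListAction
open import Data.Product using (_×_; _,_; proj₁; proj₂)
open import Data.Sum as Sum using (_⊎_; inj₁; inj₂)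
open import Data.Vec as Vec using ([]; _∷_)
import Data.Vec.Properties as Vec
open import Function using (_∘_; id)
open import Relation.Nullary using (Dec; yes; no; does; contradiction)
open import Relation.Nullary.Decidable using (dec-true; dec-false)
open import Relation.Binary.PropositionalEquality
open import Algebra.Properties.Semiring.Sum ℕ.+-*-semiring using (sum; *-distribˡ-sum)
open import Algebra.Properties.CommutativeMonoid.Sum ℕ.*-1-commutativeMonoid
  using () renaming (sum to product)

-- Spectral bound for one letter, starting with the eigenvalues.

module Spectral (c : ℕ) where

  open import Data.Integer using (_+_; _*_; _-_; -_; _^_; _≤_)

  C s : ℤ
  C = + c
  s = + suc c

  -- eigenvalue t k is the image of (s X - 1)^k under the linear functional
  -- X^i ↦ s^(t ∸ i). Pairs of subsets that meet in i points enter the form below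
  -- through multiples of X^i, and for i ≥ t the functional is evaluation at 1,
  -- where the form is diagonal.
  eigenvalue : ℕ → ℕ → ℤ
  eigenvalue t zero    = s ^ t
  eigenvalue t (suc k) = s * eigenvalue (ℕ.pred t) k - eigenvalue t k

  -- On powers `X^i` with `i ≤ t` the functional is `s^t` times evaluation at `1/s`, a root of
  -- `s X - 1`.
  eigenvalue-vanish : ∀ t k → k ℕ.< t → eigenvalue t (suc k) ≡ 0ℤ
  eigenvalue-vanish (suc t) zero    _         = ℤ.+-inverseʳ (s ^ suc t)
  eigenvalue-vanish (suc t) (suc k) (s≤s k<t) = begin
    s * eigenvalue t (suc k) - eigenvalue (suc t) (suc k)
      ≡⟨ cong₂ (λ x y → s * x - y) (eigenvalue-vanish t k k<t) (eigenvalue-vanish (suc t) k (ℕ.m≤n⇒m≤1+n k<t)) ⟩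
    s * 0ℤ - 0ℤ  ≡⟨ cong (_- 0ℤ) (ℤ.*-zeroʳ s) ⟩
    0ℤ           ∎
    where open ≡-Reasoning

  pos-^ : ∀ a k → + (a ℕ.^ k) ≡ (+ a) ^ k
  pos-^ a zero    = refl
  pos-^ a (suc k) = trans (ℤ.pos-* a (a ℕ.^ k)) (cong (+ a *_) (pos-^ a k))

  0≤^ : ∀ a k → 0ℤ ≤ (+ a) ^ k
  0≤^ a k = subst (0ℤ ≤_) (pos-^ a k) (+≤+ z≤n)

  0≤* : ∀ {a b} → 0ℤ ≤ a → 0ℤ ≤ b → 0ℤ ≤ a * b
  0≤* {+ a} {+ b} _ _ = subst (0ℤ ≤_) (ℤ.pos-* a b) (+≤+ z≤n)

  -- At `t = 0` the functional is evaluation at 1, where `s X - 1` equals `C`.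
  eigenvalue₀ : ∀ k → eigenvalue 0 k ≡ C ^ k
  eigenvalue₀ zero    = refl
  eigenvalue₀ (suc k) = trans (cong (λ x → s * x - x) (eigenvalue₀ k)) (lemma C (C ^ k))
    where
    lemma : ∀ a x → (1ℤ + a) * x - x ≡ a * x
    lemma = solve-∀

  -- With g j t = eigenvalue t (t + j) / s^t the recurrence unrolls to
  -- g (j + 1) t = C^(j+1) - (g j 1 + ... + g j t), so if every g j i lies in
  -- [0, C^j] then g (j + 1) t lies in [C^j (C - t), C^(j+1)].
  eigenvalue-bounds : ∀ j t → t ℕ.≤ c → 0ℤ ≤ eigenvalue t (t ℕ.+ j) × eigenvalue t (t ℕ.+ j) ≤ s ^ t * C ^ j
  eigenvalue-lower : ∀ j t → t ℕ.≤ c → s ^ t * (C - + t) * C ^ j ≤ eigenvalue t (t ℕ.+ suc j)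
  eigenvalue-upper : ∀ j t → t ℕ.≤ c → eigenvalue t (t ℕ.+ suc j) ≤ s ^ t * C ^ suc j

  eigenvalue-bounds zero zero    _ = +≤+ z≤n , ℤ.≤-refl
  eigenvalue-bounds zero (suc t) _ =
    subst (λ x → 0ℤ ≤ x × x ≤ s ^ suc t * 1ℤ)
      (sym (trans (cong (eigenvalue (suc t) ∘ suc) (ℕ.+-identityʳ t)) (eigenvalue-vanish (suc t) t (ℕ.n<1+n t))))
      (ℤ.≤-refl , 0≤* (0≤^ (suc c) (suc t)) (+≤+ z≤n))
  eigenvalue-bounds (suc j) t t≤c =
    -- `t ≤ c` makes the factor `C - t` of the lower bound nonnegative.
    ℤ.≤-trans (0≤* (0≤* (0≤^ (suc c) t) (ℤ.i≤j⇒0≤j-i (+≤+ t≤c))) (0≤^ c j)) (eigenvalue-lower j t t≤c) ,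
    eigenvalue-upper j t t≤c

  eigenvalue-lower j zero    _   = ℤ.≤-reflexive (trans (lemma C (C ^ j)) (sym (eigenvalue₀ (suc j))))
    where
    lemma : ∀ a x → 1ℤ * (a - 0ℤ) * x ≡ a * x
    lemma = solve-∀
  eigenvalue-lower j (suc t) t<c = begin
    s ^ suc t * (C - (1ℤ + + t)) * C ^ j
      ≡⟨ lemma s (s ^ t) C (+ t) (C ^ j) ⟩
    s * (s ^ t * (C - + t) * C ^ j) - s ^ suc t * C ^ j
      ≤⟨ ℤ.+-mono-≤ (ℤ.*-monoˡ-≤-nonNeg s (eigenvalue-lower j t (ℕ.<⇒≤ t<c)))
                    (ℤ.neg-mono-≤ (proj₂ (eigenvalue-bounds j (suc t) t<c))) ⟩
    s * eigenvalue t (t ℕ.+ suc j) - eigenvalue (suc t) (suc t ℕ.+ j)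
      ≡⟨ cong (λ k → s * eigenvalue t (t ℕ.+ suc j) - eigenvalue (suc t) k) (ℕ.+-suc t j) ⟨
    s * eigenvalue t (t ℕ.+ suc j) - eigenvalue (suc t) (t ℕ.+ suc j) ∎
    where
    open ℤ.≤-Reasoning
    lemma : ∀ s x a t y → s * x * (a - (1ℤ + t)) * y ≡ s * (x * (a - t) * y) - s * x * y
    lemma = solve-∀

  eigenvalue-upper j zero    _   = ℤ.≤-reflexive (trans (eigenvalue₀ (suc j)) (sym (ℤ.*-identityˡ _)))
  eigenvalue-upper j (suc t) t<c = begin
    s * eigenvalue t (t ℕ.+ suc j) - eigenvalue (suc t) (t ℕ.+ suc j)
      ≡⟨ cong (λ k → s * eigenvalue t (t ℕ.+ suc j) - eigenvalue (suc t) k) (ℕ.+-suc t j) ⟩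
    s * eigenvalue t (t ℕ.+ suc j) - eigenvalue (suc t) (suc t ℕ.+ j)
      ≤⟨ ℤ.+-mono-≤ (ℤ.*-monoˡ-≤-nonNeg s (eigenvalue-upper j t (ℕ.<⇒≤ t<c)))
                    (ℤ.neg-mono-≤ (proj₁ (eigenvalue-bounds j (suc t) t<c))) ⟩
    s * (s ^ t * C ^ suc j) - 0ℤ
      ≡⟨ lemma s (s ^ t) (C ^ suc j) ⟩
    s ^ suc t * C ^ suc j ∎
    where
    open ℤ.≤-Reasoning
    lemma : ∀ s x y → s * (x * y) - 0ℤ ≡ s * x * y
    lemma = solve-∀

  0≤eigenvalue : ∀ t k → t ℕ.≤ c → 0ℤ ≤ eigenvalue t k
  0≤eigenvalue t zero    _   = 0≤^ (suc c) t
  0≤eigenvalue t (suc k) t≤c with k ℕ.<? t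
  -- Indices 1 to `t` give 0; beyond them `eigenvalue-bounds` applies with `j = suc k ∸ t`.
  ... | yes k<t = ℤ.≤-reflexive (sym (eigenvalue-vanish t k k<t))
  ... | no  k≮t = subst (λ m → 0ℤ ≤ eigenvalue t m) (ℕ.m+[n∸m]≡n t≤1+k) (proj₁ (eigenvalue-bounds (suc k ℕ.∸ t) t t≤c))
    where t≤1+k = ℕ.m≤n⇒m≤1+n (ℕ.≮⇒≥ k≮t)

  -- Sums over subsets, Fourier coefficients and the form.

  ∑ : ∀ {n} → (Subset n → ℤ) → ℤ
  ∑ {zero}  h = h []
  ∑ {suc n} h = ∑ (h ∘ (outside ∷_)) + ∑ (h ∘ (inside ∷_))

  ∑-cong : ∀ {n} {g h : Subset n → ℤ} → (∀ S → g S ≡ h S) → ∑ g ≡ ∑ h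
  ∑-cong {zero}  g≡h = g≡h []
  ∑-cong {suc n} g≡h = cong₂ _+_ (∑-cong (g≡h ∘ (outside ∷_))) (∑-cong (g≡h ∘ (inside ∷_)))

  ∑-+ : ∀ {n} (g h : Subset n → ℤ) → ∑ (λ S → g S + h S) ≡ ∑ g + ∑ h
  ∑-+ {zero}  g h = refl
  ∑-+ {suc n} g h = trans
    (cong₂ _+_ (∑-+ (g ∘ (outside ∷_)) (h ∘ (outside ∷_))) (∑-+ (g ∘ (inside ∷_)) (h ∘ (inside ∷_))))
    (lemma (∑ (g ∘ (outside ∷_))) (∑ (h ∘ (outside ∷_))) (∑ (g ∘ (inside ∷_))) (∑ (h ∘ (inside ∷_))))
    where
    lemma : ∀ a b c d → (a + b) + (c + d) ≡ (a + c) + (b + d)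
    lemma = solve-∀

  ∑-* : ∀ {n} a (h : Subset n → ℤ) → ∑ (λ S → a * h S) ≡ a * ∑ h
  ∑-* {zero}  a h = refl
  ∑-* {suc n} a h = trans
    (cong₂ _+_ (∑-* a (h ∘ (outside ∷_))) (∑-* a (h ∘ (inside ∷_))))
    (sym (ℤ.*-distribˡ-+ a (∑ (h ∘ (outside ∷_))) (∑ (h ∘ (inside ∷_)))))

  0≤∑ : ∀ {n} {h : Subset n → ℤ} → (∀ S → 0ℤ ≤ h S) → 0ℤ ≤ ∑ h
  0≤∑ {zero}  0≤h = 0≤h []
  0≤∑ {suc n} 0≤h = ℤ.+-mono-≤ (0≤∑ (0≤h ∘ (outside ∷_))) (0≤∑ (0≤h ∘ (inside ∷_)))

  h⊥≤∑ : ∀ {n} (h : Subset n → ℤ) → (∀ S → 0ℤ ≤ h S) → h ⊥ ≤ ∑ h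
  h⊥≤∑ {zero}  h 0≤h = ℤ.≤-refl
  h⊥≤∑ {suc n} h 0≤h = subst (_≤ ∑ h) (ℤ.+-identityʳ (h ⊥))
    (ℤ.+-mono-≤ (h⊥≤∑ (h ∘ (outside ∷_)) (0≤h ∘ (outside ∷_))) (0≤∑ (0≤h ∘ (inside ∷_))))

  -- C f₀ + f₁ and f₁ - f₀ are the pairings, for the weights C, 1 on {0, 1},
  -- with the constant 1 and (up to scaling) with its orthogonal complement.
  fourier : ∀ {n} → Subset n → (Subset n → ℤ) → ℤ
  fourier []            f = f []
  fourier (outside ∷ S) f = C * fourier S (f ∘ (outside ∷_)) + fourier S (f ∘ (inside ∷_))
  fourier (inside  ∷ S) f = fourier S (f ∘ (inside ∷_)) - fourier S (f ∘ (outside ∷_))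

  -- Bilinear, because splitting off a coordinate pairs different restrictions of one function.
  form : ∀ {n} → ℕ → (Subset n → ℤ) → (Subset n → ℤ) → ℤ
  form t f g = ∑ λ S → eigenvalue t ∣ S ∣ * (fourier S f * fourier S g)

  infixl 5 _⊕_
  _⊕_ : ∀ {x y z w : ℤ} → x ≡ y → z ≡ w → x + z ≡ y + w
  _⊕_ = cong₂ _+_

  -- By the recurrence for `eigenvalue`, the `f₁ g₁` terms at level `t` cancel, so this pair
  -- survives only at level `t⁻`: two sets sharing the first point need one common point fewer among
  -- the rest.
  form-step : ∀ {n} t (f g : Subset (suc n) → ℤ) →
    let f₀ = f ∘ (outside ∷_) ; f₁ = f ∘ (inside ∷_)
        g₀ = g ∘ (outside ∷_) ; g₁ = g ∘ (inside ∷_) ; t⁻ = ℕ.pred t in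
    form t f g ≡ s * ((C - 1ℤ) * form t f₀ g₀ + form t f₀ g₁ + form t f₁ g₀
                   + (form t⁻ f₁ g₁ + - 1ℤ * form t⁻ f₁ g₀ + - 1ℤ * form t⁻ f₀ g₁ + form t⁻ f₀ g₀))
  form-step {n} t f g = begin
    form t f g
      ≡⟨ ∑-+ {n} _ _ ⟨
    (∑ λ S → eigenvalue t ∣ S ∣ * (fourier (outside ∷ S) f * fourier (outside ∷ S) g)
           + eigenvalue t (suc ∣ S ∣) * (fourier (inside ∷ S) f * fourier (inside ∷ S) g))
      ≡⟨ ∑-cong (λ S → lemma C (eigenvalue t ∣ S ∣) (eigenvalue t⁻ ∣ S ∣)
                            (fourier S f₀) (fourier S f₁) (fourier S g₀) (fourier S g₁)) ⟩
    (∑ λ S → s * ((C - 1ℤ) * v t f₀ g₀ S + v t f₀ g₁ S + v t f₁ g₀ S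
                   + (v t⁻ f₁ g₁ S + - 1ℤ * v t⁻ f₁ g₀ S + - 1ℤ * v t⁻ f₀ g₁ S + v t⁻ f₀ g₀ S)))
      ≡⟨ trans (∑-* {n} s _) (cong (s *_) (
           ∑-+ {n} _ _ ⟫ (∑-+ {n} _ _ ⟫ (∑-+ {n} _ _ ⟫ ∑-* {n} (C - 1ℤ) _ ⊕ refl) ⊕ refl)
                   ⊕ (∑-+ {n} _ _ ⟫ (∑-+ {n} _ _ ⟫
                       (∑-+ {n} _ _ ⟫ refl {x = form t⁻ f₁ g₁} ⊕ ∑-* {n} (- 1ℤ) _)
                       ⊕ ∑-* {n} (- 1ℤ) _) ⊕ refl))) ⟩
    s * ((C - 1ℤ) * form t f₀ g₀ + form t f₀ g₁ + form t f₁ g₀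
         + (form t⁻ f₁ g₁ + - 1ℤ * form t⁻ f₁ g₀ + - 1ℤ * form t⁻ f₀ g₁ + form t⁻ f₀ g₀)) ∎
    where
    open ≡-Reasoning
    t⁻ = ℕ.pred t
    f₀ = f ∘ (outside ∷_)
    f₁ = f ∘ (inside ∷_)
    g₀ = g ∘ (outside ∷_)
    g₁ = g ∘ (inside ∷_)
    v : ℕ → (Subset n → ℤ) → (Subset n → ℤ) → Subset n → ℤ
    v t f g S = eigenvalue t ∣ S ∣ * (fourier S f * fourier S g)
    infixr 4 _⟫_
    _⟫_ : ∀ {x y z : ℤ} → x ≡ y → y ≡ z → x ≡ z
    _⟫_ = trans
    lemma : ∀ c e e⁻ a₀ a₁ b₀ b₁ →
      e * ((c * a₀ + a₁) * (c * b₀ + b₁)) + ((1ℤ + c) * e⁻ - e) * ((a₁ - a₀) * (b₁ - b₀))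
      ≡ (1ℤ + c) * ((c - 1ℤ) * (e * (a₀ * b₀)) + e * (a₀ * b₁) + e * (a₁ * b₀)
          + (e⁻ * (a₁ * b₁) + - 1ℤ * (e⁻ * (a₁ * b₀)) + - 1ℤ * (e⁻ * (a₀ * b₁)) + e⁻ * (a₀ * b₀)))
    lemma = solve-∀

  CrossIntersecting : ∀ {n} → ℕ → (f g : Subset n → ℤ) → Set
  CrossIntersecting t f g = ∀ p q → t ℕ.≤ ∣ p ∩ q ∣ ⊎ f p * g q ≡ 0ℤ

  -- Induction by `form-step`. Each pair of restrictions is cross-intersecting at every level where
  -- it occurs, so each smaller form equals `s^n` times a diagonal sum independent of the level. The
  -- mixed terms at levels `t` and `t⁻` then cancel, and the coefficients of `f₀ g₀` add up to `C`.
  form-diagonal : ∀ {n} t (f g : Subset n → ℤ) → CrossIntersecting t f g →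
    form t f g ≡ s ^ n * fourier ⊥ (λ p → f p * g p)
  form-diagonal {zero} zero f g _ = refl
  form-diagonal {zero} (suc t) f g f⋈g with f⋈g [] []
  -- Without coordinates the sets meet in 0 points, so `suc t ≤ 0` is absurd and the product
  -- vanishes.
  ... | inj₂ fg≡0 rewrite fg≡0 = ℤ.*-zeroʳ (s ^ suc t)
  form-diagonal {suc n} t f g f⋈g =
    trans (form-step t f g) (trans
      (cong (s *_)
        (cong ((C - 1ℤ) *_) (form-diagonal t f₀ g₀ ⋈₀₀) ⊕ form-diagonal t f₀ g₁ ⋈₀₁ ⊕ form-diagonal t f₁ g₀ ⋈₁₀
          ⊕ (form-diagonal t⁻ f₁ g₁ ⋈₁₁ ⊕ cong (- 1ℤ *_) (form-diagonal t⁻ f₁ g₀ (weaken f₁ g₀ ⋈₁₀))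
            ⊕ cong (- 1ℤ *_) (form-diagonal t⁻ f₀ g₁ (weaken f₀ g₁ ⋈₀₁)) ⊕ form-diagonal t⁻ f₀ g₀ (weaken f₀ g₀ ⋈₀₀))))
      (lemma s (s ^ n) C _ _ (fourier ⊥ (λ p → f₁ p * g₀ p)) (fourier ⊥ (λ p → f₁ p * g₁ p))))
    where
    t⁻ = ℕ.pred t
    f₀ = f ∘ (outside ∷_)
    f₁ = f ∘ (inside ∷_)
    g₀ = g ∘ (outside ∷_)
    g₁ = g ∘ (inside ∷_)
    ⋈₀₀ : CrossIntersecting t f₀ g₀
    ⋈₀₀ p q = f⋈g (outside ∷ p) (outside ∷ q)
    ⋈₀₁ : CrossIntersecting t f₀ g₁
    ⋈₀₁ p q = f⋈g (outside ∷ p) (inside ∷ q)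
    ⋈₁₀ : CrossIntersecting t f₁ g₀
    ⋈₁₀ p q = f⋈g (inside ∷ p) (outside ∷ q)
    ⋈₁₁ : CrossIntersecting (ℕ.pred t) f₁ g₁
    ⋈₁₁ p q = Sum.map₁ ℕ.pred-mono-≤ (f⋈g (inside ∷ p) (inside ∷ q))
    weaken : ∀ (f g : Subset n → ℤ) → CrossIntersecting t f g → CrossIntersecting (ℕ.pred t) f g
    weaken _ _ ⋈ p q = Sum.map₁ (ℕ.≤-trans ℕ.pred[n]≤n) (⋈ p q)
    lemma : ∀ s x c a b d e →
      s * ((c - 1ℤ) * (x * a) + x * b + x * d + (x * e + - 1ℤ * (x * d) + - 1ℤ * (x * b) + x * a))
      ≡ s * x * (c * a + e)
    lemma = solve-∀

  -- Biased weights and the Hoffman bound.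

  weight : ∀ {n} → (Subset n → ℕ) → ℕ
  weight {zero}  f = f []
  weight {suc n} f = c ℕ.* weight (f ∘ (outside ∷_)) ℕ.+ weight (f ∘ (inside ∷_))

  fourier-⊥≡weight : ∀ {n} (f : Subset n → ℤ) (u : Subset n → ℕ) → (∀ p → f p ≡ + u p) → fourier ⊥ f ≡ + weight u
  fourier-⊥≡weight {zero}  f u f≡u = f≡u []
  fourier-⊥≡weight {suc n} f u f≡u = begin
    C * fourier ⊥ (f ∘ (outside ∷_)) + fourier ⊥ (f ∘ (inside ∷_))
      ≡⟨ cong₂ (λ x y → C * x + y) (fourier-⊥≡weight _ _ (f≡u ∘ (outside ∷_))) (fourier-⊥≡weight _ _ (f≡u ∘ (inside ∷_))) ⟩
    C * + w₀ + + w₁       ≡⟨ cong (_+ + w₁) (ℤ.pos-* c w₀) ⟨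
    + (c ℕ.* w₀) + + w₁   ≡⟨ ℤ.pos-+ (c ℕ.* w₀) w₁ ⟨
    + weight u            ∎
    where
    open ≡-Reasoning
    w₀ = weight (u ∘ (outside ∷_))
    w₁ = weight (u ∘ (inside ∷_))

  0≤x² : ∀ x → 0ℤ ≤ x * x
  0≤x² (+ m)      = 0≤* {+ m} {+ m} (+≤+ z≤n) (+≤+ z≤n)
  0≤x² ℤ.-[1+ m ] = +≤+ z≤n

  -- With `w = weight u` the chain is `s^t w² ≤ form t f f = s^n w`; idempotence of `u` turns the
  -- diagonal sum of `f²` into `w`.
  weight-bound : ∀ {n} t (u : Subset n → ℕ) → t ℕ.≤ c → (∀ p → u p ℕ.* u p ≡ u p) →
    (∀ p q → t ℕ.≤ ∣ p ∩ q ∣ ⊎ u p ℕ.* u q ≡ 0) → suc c ℕ.^ t ℕ.* weight u ℕ.≤ suc c ℕ.^ n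
  weight-bound {n} t u t≤c u²≡u u⋈u = cancel (weight u) (ℤ.drop‿+≤+ quadratic)
    where
    f : Subset n → ℤ
    f = +_ ∘ u
    pos-square : ∀ m w → + (m ℕ.* w ℕ.* w) ≡ + m * (+ w * + w)
    pos-square m w = trans (ℤ.pos-* (m ℕ.* w) w) (trans (cong (_* + w) (ℤ.pos-* m w)) (ℤ.*-assoc (+ m) (+ w) (+ w)))
    quadratic : + (suc c ℕ.^ t ℕ.* weight u ℕ.* weight u) ≤ + (suc c ℕ.^ n ℕ.* weight u)
    quadratic = begin
      + (suc c ℕ.^ t ℕ.* weight u ℕ.* weight u)
        ≡⟨ pos-square (suc c ℕ.^ t) (weight u) ⟩
      + (suc c ℕ.^ t) * (+ weight u * + weight u)
        ≡⟨ cong₂ (λ x w → x * (w * w)) (pos-^ (suc c) t) (sym (fourier-⊥≡weight f u λ _ → refl)) ⟩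
      eigenvalue t 0 * (fourier ⊥ f * fourier ⊥ f)
        ≡⟨ cong (λ k → eigenvalue t k * (fourier ⊥ f * fourier ⊥ f)) (∣⊥∣≡0 n) ⟨
      eigenvalue t ∣ ⊥ {n} ∣ * (fourier ⊥ f * fourier ⊥ f)
        ≤⟨ h⊥≤∑ _ (λ S → 0≤* (0≤eigenvalue t ∣ S ∣ t≤c) (0≤x² (fourier S f))) ⟩
      form t f f
        ≡⟨ form-diagonal t f f (λ p q → Sum.map₂ (λ uu≡0 → trans (sym (ℤ.pos-* (u p) (u q))) (cong +_ uu≡0)) (u⋈u p q)) ⟩
      s ^ n * fourier ⊥ (λ p → f p * f p)
        ≡⟨ cong (s ^ n *_) (fourier-⊥≡weight _ u λ p → trans (sym (ℤ.pos-* (u p) (u p))) (cong +_ (u²≡u p))) ⟩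
      s ^ n * + weight u
        ≡⟨ cong (_* + weight u) (pos-^ (suc c) n) ⟨
      + (suc c ℕ.^ n) * + weight u
        ≡⟨ ℤ.pos-* (suc c ℕ.^ n) (weight u) ⟨
      + (suc c ℕ.^ n ℕ.* weight u) ∎
      where open ℤ.≤-Reasoning
    -- Cancelling `w` requires `w > 0`; at `w = 0` the bound is trivial.
    cancel : ∀ w → suc c ℕ.^ t ℕ.* w ℕ.* w ℕ.≤ suc c ℕ.^ n ℕ.* w → suc c ℕ.^ t ℕ.* w ℕ.≤ suc c ℕ.^ n
    cancel zero    _  = subst (ℕ._≤ suc c ℕ.^ n) (sym (ℕ.*-zeroʳ (suc c ℕ.^ t))) z≤n
    cancel (suc w) le = ℕ.*-cancelʳ-≤ _ _ (suc w) le

open import Data.Nat using (_+_; _*_; _^_; _∸_; _≤_; _<_)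

-- Sums over words and counting.

sum-mono-≤ : ∀ {m} {f g : Fin m → ℕ} → (∀ i → f i ≤ g i) → sum f ≤ sum g
sum-mono-≤ {zero}  f≤g = z≤n
sum-mono-≤ {suc m} f≤g = ℕ.+-mono-≤ (f≤g zero) (sum-mono-≤ (f≤g ∘ suc))

sum-mono-< : ∀ {m} {f g : Fin m → ℕ} → (∀ i → f i ≤ g i) → ∀ i → f i < g i → sum f < sum g
sum-mono-< f≤g zero    f<g = ℕ.+-mono-<-≤ f<g (sum-mono-≤ (f≤g ∘ suc))
sum-mono-< f≤g (suc i) f<g = ℕ.+-mono-≤-< (f≤g zero) (sum-mono-< (f≤g ∘ suc) i f<g)

∑ʷ : ∀ {s n} → (Word s n → ℕ) → ℕ
∑ʷ {n = zero}  g = g []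
∑ʷ {n = suc n} g = sum λ a → ∑ʷ (g ∘ (a ∷_))

∑ʷ-mono-≤ : ∀ {s n} {f g : Word s n → ℕ} → (∀ y → f y ≤ g y) → ∑ʷ f ≤ ∑ʷ g
∑ʷ-mono-≤ {n = zero}  f≤g = f≤g []
∑ʷ-mono-≤ {n = suc n} f≤g = sum-mono-≤ λ a → ∑ʷ-mono-≤ (f≤g ∘ (a ∷_))

∑ʷ-mono-< : ∀ {s n} {f g : Word s n → ℕ} → (∀ y → f y ≤ g y) → ∀ y → f y < g y → ∑ʷ f < ∑ʷ g
∑ʷ-mono-< f≤g []      f<g = f<g
∑ʷ-mono-< f≤g (a ∷ y) f<g =
  sum-mono-< (λ b → ∑ʷ-mono-≤ (f≤g ∘ (b ∷_))) a (∑ʷ-mono-< (f≤g ∘ (a ∷_)) y f<g)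

-- Setting `g` to 0 at the head `x` strictly lowers the sum, and uniqueness leaves the values of `g`
-- on the tail unchanged.
length≤∑ʷ : ∀ {s n} (F : List (Word s n)) → Unique F →
  (g : Word s n → ℕ) → (∀ {y} → y ∈ F → 1 ≤ g y) → length F ≤ ∑ʷ g
length≤∑ʷ []      _             g 1≤g = z≤n
length≤∑ʷ {s} {n} (x ∷ F) (x∉F ∷ F-unique) g 1≤g =
  ℕ.≤-<-trans (length≤∑ʷ F F-unique h 1≤h) (∑ʷ-mono-< h≤g x hx<gx)
  where
  _≟ʷ_ : (y z : Word s n) → Dec (y ≡ z)
  _≟ʷ_ = Vec.≡-dec _≟_
  h : Word s n → ℕ
  h y = if does (x ≟ʷ y) then 0 else g y
  1≤h : ∀ {y} → y ∈ F → 1 ≤ h y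
  1≤h {y} y∈F rewrite dec-false (x ≟ʷ y) (All.lookup x∉F y∈F) = 1≤g (there y∈F)
  h≤g : ∀ y → h y ≤ g y
  h≤g y with does (x ≟ʷ y)
  ... | true  = z≤n
  ... | false = ℕ.≤-refl
  hx<gx : h x < g x
  hx<gx rewrite dec-true (x ≟ʷ x) refl = 1≤g (here refl)

1≤product : ∀ {m} {f : Fin m → ℕ} → (∀ i → 1 ≤ f i) → 1 ≤ product f
1≤product {zero}  1≤f = ℕ.≤-refl
1≤product {suc m} 1≤f = ℕ.*-mono-≤ (1≤f zero) (1≤product (1≤f ∘ suc))

totalT≡sum : ∀ {s} (t : Fin s → ℕ) → totalT t ≡ sum t
totalT≡sum t = trans (cong ListAction.sum (map-tabulate id t)) (go t)
  where
  go : ∀ {m} (t : Fin m → ℕ) → ListAction.sum (List.tabulate t) ≡ sum t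
  go {zero}  t = refl
  go {suc m} t = cong (t zero ℕ.+_) (go (t ∘ suc))

-- Monotone families and traces of words.

Monotone : ∀ {n} → (Subset n → ℕ) → Set
Monotone u = ∀ {p q} → p ⊆ q → u p ≤ u q

trace : ∀ {s n} → Fin s → Word s n → Subset n
trace ℓ = Vec.map λ a → does (a ≟ ℓ)

∣trace∩trace∣ : ∀ {s n} (ℓ : Fin s) (y z : Word s n) → ∣ trace ℓ y ∩ trace ℓ z ∣ ≡ agreeOn ℓ y z
∣trace∩trace∣ ℓ []      []      = refl
∣trace∩trace∣ ℓ (a ∷ y) (b ∷ z) with does (a ≟ ℓ) | does (b ≟ ℓ)
... | true  | true  = cong suc (∣trace∩trace∣ ℓ y z)
... | true  | false = ∣trace∩trace∣ ℓ y z
... | false | true  = ∣trace∩trace∣ ℓ y z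
... | false | false = ∣trace∩trace∣ ℓ y z

∩-mono-⊆ : ∀ {n} {p p′ q q′ : Subset n} → p ⊆ p′ → q ⊆ q′ → p ∩ q ⊆ p′ ∩ q′
∩-mono-⊆ {p = p} {q = q} p⊆p′ q⊆q′ x∈p∩q with x∈p∩q⁻ p q x∈p∩q
... | x∈p , x∈q = x∈p∩q⁺ (p⊆p′ x∈p , q⊆q′ x∈q)

-- Negative correlation.

module Correlation (c : ℕ) where

  open Spectral c using (weight)

  s : ℕ
  s = suc c

  weight-mono : ∀ {n} {u v : Subset n → ℕ} → (∀ p → u p ≤ v p) → weight u ≤ weight v
  weight-mono {zero}  u≤v = u≤v []
  weight-mono {suc n} u≤v =
    ℕ.+-mono-≤ (ℕ.*-monoʳ-≤ c (weight-mono (u≤v ∘ (outside ∷_)))) (weight-mono (u≤v ∘ (inside ∷_)))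

  -- `s` times the expectation when `true` has probability `1/s`; this is one recursion step of
  -- `weight`.
  mean : (Bool → ℕ) → ℕ
  mean w = c * w false + w true

  -- Each factor `s` is spent on one index: `s * w i false ≤ mean (w i)`.
  product-false≤mean : ∀ {m} (w : Fin m → Bool → ℕ) → (∀ i → w i false ≤ w i true) →
    s ^ m * product (λ i → w i false) ≤ product (mean ∘ w)
  product-false≤mean {zero}  w w≤ = ℕ.≤-refl
  product-false≤mean {suc m} w w≤ = begin
    s * s ^ m * (A * product (λ i → w (suc i) false))
      ≡⟨ lemma s (s ^ m) A _ ⟩
    s * A * (s ^ m * product (λ i → w (suc i) false))
      ≤⟨ ℕ.*-mono-≤ sA≤mean (product-false≤mean (w ∘ suc) (w≤ ∘ suc)) ⟩
    mean (w zero) * product (mean ∘ w ∘ suc) ∎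
    where
    open ℕ.≤-Reasoning
    A = w zero false
    sA≤mean : s * A ≤ mean (w zero)
    sA≤mean = subst (_≤ mean (w zero)) (ℕ.+-comm (c * A) A) (ℕ.+-monoʳ-≤ (c * A) (w≤ zero))
    lemma : ∀ s x a b → s * x * (a * b) ≡ s * a * (x * b)
    lemma = ℕ-Solver.solve-∀

  one-hot-sum : ∀ {m} → (Fin m → Bool → ℕ) → ℕ
  one-hot-sum w = sum λ a → product λ i → w i (does (a ≟ i))

  -- A uniform letter among `s`, of which only `m` are observed, misses all of these in `s - m`
  -- cases. This accounts for the all-false terms, arranged to avoid subtraction, and lets the
  -- induction run over `m` with `s` fixed.
  one-hot-≤ : ∀ {m} (w : Fin m → Bool → ℕ) → (∀ i → w i false ≤ w i true) →
    s ^ m * one-hot-sum w + s * (s ^ m * product (λ i → w i false))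
    ≤ s * product (mean ∘ w) + m * (s ^ m * product (λ i → w i false))
  one-hot-≤ {zero}  w w≤ = ℕ.≤-reflexive (lemma s)
    where
    lemma : ∀ s → s * 1 ≡ s * 1 + 0
    lemma = ℕ-Solver.solve-∀
  one-hot-≤ {suc m} w w≤
    with ℕ.m≤n⇒∃[o]m+o≡n (w≤ zero)
       | ℕ.m≤n⇒∃[o]m+o≡n (product-false≤mean (w ∘ suc) (w≤ ∘ suc))
  -- Beyond the induction hypothesis only (B - A) (Q - P) ≥ 0 is needed.
  ... | d , A+d≡B | e , P+e≡Q = begin
    s * σ * (B * p + sum (λ a → A * product λ i → w (suc i) (does (a ≟ i)))) + s * (s * σ * (A * p))
      ≡⟨ cong (λ X → s * σ * (B * p + X) + s * (s * σ * (A * p)))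
              (*-distribˡ-sum A (λ a → product λ i → w (suc i) (does (a ≟ i)))) ⟨
    s * σ * (B * p + A * one-hot-sum (w ∘ suc)) + s * (s * σ * (A * p))
      ≡⟨ lemma₁ s σ A B p (one-hot-sum (w ∘ suc)) ⟩
    s * (B * P) + s * A * (σ * one-hot-sum (w ∘ suc) + s * P)
      ≤⟨ ℕ.+-monoʳ-≤ (s * (B * P)) (ℕ.*-monoʳ-≤ (s * A) (one-hot-≤ (w ∘ suc) (w≤ ∘ suc))) ⟩
    s * (B * P) + s * A * (s * Q + m * P)
      ≤⟨ ℕ.m≤m+n _ (s * (d * e)) ⟩
    s * (B * P) + s * A * (s * Q + m * P) + s * (d * e)
      ≡⟨ cong₂ (λ B Q → s * (B * P) + s * A * (s * Q + m * P) + s * (d * e)) A+d≡B P+e≡Q ⟨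
    s * ((A + d) * P) + s * A * (s * (P + e) + m * P) + s * (d * e)
      ≡⟨ lemma₂ c A d P e m ⟩
    s * ((c * A + (A + d)) * (P + e)) + suc m * (s * A * P)
      ≡⟨ cong₂ (λ B Q → s * ((c * A + B) * Q) + suc m * (s * A * P)) A+d≡B P+e≡Q ⟩
    s * ((c * A + B) * Q) + suc m * (s * A * P)
      ≡⟨ cong (λ X → s * ((c * A + B) * Q) + suc m * X) (lemma₃ s A σ p) ⟩
    s * ((c * A + B) * Q) + suc m * (s * σ * (A * p)) ∎
    where
    open ℕ.≤-Reasoning
    A = w zero false
    B = w zero true
    σ = s ^ m
    p = product (λ i → w (suc i) false)
    P = σ * p
    Q = product (mean ∘ w ∘ suc)
    lemma₁ : ∀ s σ a b p x →
      s * σ * (b * p + a * x) + s * (s * σ * (a * p)) ≡ s * (b * (σ * p)) + s * a * (σ * x + s * (σ * p))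
    lemma₁ = ℕ-Solver.solve-∀
    lemma₂ : ∀ c a d p e m →
      suc c * ((a + d) * p) + suc c * a * (suc c * (p + e) + m * p) + suc c * (d * e)
      ≡ suc c * ((c * a + (a + d)) * (p + e)) + suc m * (suc c * a * p)
    lemma₂ = ℕ-Solver.solve-∀
    lemma₃ : ∀ s a σ p → s * a * (σ * p) ≡ s * σ * (a * p)
    lemma₃ = ℕ-Solver.solve-∀

  -- After division by the total masses this compares the expectation of a product with the product
  -- of expectations. Fix the first letter `a`, apply the induction hypothesis to the families
  -- restricted by `a`, then `one-hot-≤` to the weights of the restrictions.
  negative-correlation : ∀ {n} (u : Fin s → Subset n → ℕ) → (∀ ℓ → Monotone (u ℓ)) →
    s ^ (n * s) * ∑ʷ (λ y → product λ ℓ → u ℓ (trace ℓ y)) ≤ s ^ n * product (weight ∘ u)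
  negative-correlation {zero}  u _      = ℕ.≤-refl
  negative-correlation {suc n} u u-mono = begin
    s ^ (s + n * s) * sum Σ′
      ≡⟨ cong (_* sum Σ′) (ℕ.^-distribˡ-+-* s s (n * s)) ⟩
    s ^ s * s ^ (n * s) * sum Σ′
      ≡⟨ ℕ.*-assoc (s ^ s) (s ^ (n * s)) (sum Σ′) ⟩
    s ^ s * (s ^ (n * s) * sum Σ′)
      ≡⟨ cong (s ^ s *_) (*-distribˡ-sum (s ^ (n * s)) Σ′) ⟩
    s ^ s * sum (λ a → s ^ (n * s) * Σ′ a)
      ≤⟨ ℕ.*-monoʳ-≤ (s ^ s) (sum-mono-≤ λ a →
           negative-correlation (λ ℓ → u ℓ ∘ (does (a ≟ ℓ) ∷_)) (λ ℓ → u-mono ℓ ∘ s⊆s)) ⟩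
    s ^ s * sum (λ a → s ^ n * product (λ ℓ → w ℓ (does (a ≟ ℓ))))
      ≡⟨ cong (s ^ s *_) (*-distribˡ-sum (s ^ n) (λ a → product λ ℓ → w ℓ (does (a ≟ ℓ)))) ⟨
    s ^ s * (s ^ n * one-hot-sum w)
      ≡⟨ lemma (s ^ s) (s ^ n) (one-hot-sum w) ⟩
    s ^ n * (s ^ s * one-hot-sum w)
      -- Here `m = s`, so the all-false terms on the two sides coincide and cancel.
      ≤⟨ ℕ.*-monoʳ-≤ (s ^ n) (ℕ.+-cancelʳ-≤ _ _ _
           (one-hot-≤ w λ ℓ → weight-mono {n} λ p → u-mono ℓ (out⊆ (⊆-refl {x = p})))) ⟩
    s ^ n * (s * product (mean ∘ w))
      ≡⟨ lemma′ (s ^ n) s (product (mean ∘ w)) ⟩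
    s * s ^ n * product (weight ∘ u) ∎
    where
    open ℕ.≤-Reasoning
    Σ′ : Fin s → ℕ
    Σ′ a = ∑ʷ λ y → product λ ℓ → u ℓ (trace ℓ (a ∷ y))
    w : Fin s → Bool → ℕ
    w ℓ b = weight (u ℓ ∘ (b ∷_))
    lemma : ∀ x y z → x * (y * z) ≡ y * (x * z)
    lemma = ℕ-Solver.solve-∀
    lemma′ : ∀ x s z → x * (s * z) ≡ s * x * z
    lemma′ = ℕ-Solver.solve-∀

-- Products of bounds over the letters, and the up-closures they apply to.

^-sum-*-product≤ : ∀ {m} b x (t w : Fin m → ℕ) → (∀ i → b ^ t i * w i ≤ x) →
  b ^ sum t * product w ≤ x ^ m
^-sum-*-product≤ {zero}  b x t w _  = ℕ.≤-refl
^-sum-*-product≤ {suc m} b x t w bw≤x = begin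
  b ^ (t zero + sum (t ∘ suc)) * (w zero * product (w ∘ suc))
    ≡⟨ cong (_* (w zero * product (w ∘ suc))) (ℕ.^-distribˡ-+-* b (t zero) _) ⟩
  b ^ t zero * b ^ sum (t ∘ suc) * (w zero * product (w ∘ suc))
    ≡⟨ lemma (b ^ t zero) _ (w zero) _ ⟩
  b ^ t zero * w zero * (b ^ sum (t ∘ suc) * product (w ∘ suc))
    ≤⟨ ℕ.*-mono-≤ (bw≤x zero) (^-sum-*-product≤ b x (t ∘ suc) (w ∘ suc) (bw≤x ∘ suc)) ⟩
  x * x ^ m ∎
  where
  open ℕ.≤-Reasoning
  lemma : ∀ a b c d → a * b * (c * d) ≡ a * c * (b * d)
  lemma = ℕ-Solver.solve-∀

module UpClosure {s n : ℕ} (F : List (Word s n)) (ℓ : Fin s) where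

  Covers : Subset n → Word s n → Set
  Covers p y = trace ℓ y ⊆ p

  generated? : ∀ p → Dec (Any (Covers p) F)
  generated? p = any? (λ y → trace ℓ y ⊆? p) F

  up : Subset n → ℕ
  up p = if does (generated? p) then 1 else 0

  up-monotone : Monotone up
  up-monotone {p} {q} p⊆q with generated? p | generated? q
  ... | yes _ | yes _ = ℕ.≤-refl
  ... | no  _ | _     = z≤n
  ... | yes y | no ¬y =
    contradiction (Any.map {P = Covers p} {Q = Covers q} (λ y⊆p → ⊆-trans y⊆p p⊆q) y) ¬y

  up-idempotent : ∀ p → up p * up p ≡ up p
  up-idempotent p with does (generated? p)
  ... | true  = refl
  ... | false = refl

  up-trace : ∀ {y} → y ∈ F → 1 ≤ up (trace ℓ y)
  up-trace {y} y∈F rewrite dec-true (generated? (trace ℓ y)) (lose y∈F ⊆-refl) = ℕ.≤-refl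

  -- `p` and `q` contain the traces of some `y` and `z` in `F`, and these traces already meet in
  -- `agreeOn ℓ y z` points.
  up-intersecting : ∀ {t} → IsIntersecting t F → ∀ p q → t ℓ ≤ ∣ p ∩ q ∣ ⊎ up p * up q ≡ 0
  up-intersecting F⋈F p q with generated? p | generated? q
  ... | no _   | _      = inj₂ refl
  ... | yes _  | no _   = inj₂ refl
  ... | yes y≤ | yes z≤ with find y≤ | find z≤
  ...   | y , y∈F , y⊆p | z , z∈F , z⊆q = inj₁ (ℕ.≤-trans
    (subst (_ ≤_) (sym (∣trace∩trace∣ ℓ y z)) (F⋈F y z y∈F z∈F ℓ))
    (p⊆q⇒∣p∣≤∣q∣ (∩-mono-⊆ y⊆p z⊆q)))

theorem4 : (s n : ℕ) → 2 ≤ s → 1 ≤ n → (t : Fin s → ℕ) →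
    (∀ (i : Fin s) → t i < s) → totalT t ≤ n →
    (F : List (Word s n)) → Unique F → IsIntersecting t F →
    length F ≤ s ^ (n ∸ totalT t)
theorem4 (suc c) n _ _ t t<s T≤n F F-unique F⋈F =
  -- The factor `s ^ T` removes the truncated subtraction; `s ^ (n * s)` in `scaled` is the total
  -- mass of the product of the `s` weights.
  ℕ.*-cancelʳ-≤ _ _ (s ^ T) {{ℕ.m^n≢0 s T}} (begin
    length F * s ^ T       ≤⟨ ℕ.*-cancelˡ-≤ (s ^ (n * s)) {{ℕ.m^n≢0 s (n * s)}} scaled ⟩
    s ^ n                  ≡⟨ cong (s ^_) (ℕ.m∸n+n≡m T≤n) ⟨
    s ^ (n ∸ T + T)        ≡⟨ ℕ.^-distribˡ-+-* s (n ∸ T) T ⟩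
    s ^ (n ∸ T) * s ^ T    ∎)
  where
  open ℕ.≤-Reasoning
  open Spectral c using (weight; weight-bound)
  open Correlation c using (s; negative-correlation)
  open UpClosure F
  T = totalT t
  W = product (weight ∘ up)
  ∑F = ∑ʷ λ y → product λ ℓ → up ℓ (trace ℓ y)
  scaled : s ^ (n * s) * (length F * s ^ T) ≤ s ^ (n * s) * s ^ n
  scaled = begin
    s ^ (n * s) * (length F * s ^ T)
      -- All traces of a word of `F` lie in the up-closures, so its term in `∑F` is at least 1.
      ≤⟨ ℕ.*-monoʳ-≤ (s ^ (n * s)) (ℕ.*-monoˡ-≤ (s ^ T)
           (length≤∑ʷ F F-unique _ λ y∈F → 1≤product λ ℓ → up-trace ℓ y∈F)) ⟩
    s ^ (n * s) * (∑F * s ^ T)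
      ≡⟨ ℕ.*-assoc (s ^ (n * s)) ∑F (s ^ T) ⟨
    s ^ (n * s) * ∑F * s ^ T
      ≤⟨ ℕ.*-monoˡ-≤ (s ^ T) (negative-correlation up up-monotone) ⟩
    s ^ n * W * s ^ T
      ≡⟨ trans (ℕ.*-assoc (s ^ n) W (s ^ T)) (cong (s ^ n *_) (ℕ.*-comm W (s ^ T))) ⟩
    s ^ n * (s ^ T * W)
      ≡⟨ cong (λ T → s ^ n * (s ^ T * W)) (totalT≡sum t) ⟩
    s ^ n * (s ^ sum t * W)
      -- `t ℓ < suc c` becomes `t ℓ ≤ c`, which ensures nonnegative eigenvalues for each letter.
      ≤⟨ ℕ.*-monoʳ-≤ (s ^ n) (^-sum-*-product≤ s (s ^ n) t (weight ∘ up) λ ℓ →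
           weight-bound (t ℓ) (up ℓ) (ℕ.≤-pred (t<s ℓ)) (up-idempotent ℓ) (up-intersecting ℓ F⋈F)) ⟩
    s ^ n * (s ^ n) ^ s
      ≡⟨ cong (s ^ n *_) (ℕ.^-*-assoc s n s) ⟩
    s ^ n * s ^ (n * s)
      ≡⟨ ℕ.*-comm (s ^ n) (s ^ (n * s)) ⟩
    s ^ (n * s) * s ^ n ∎
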